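{- Let $m, n$ be arbitrary integers, and put $R = m^4 - 6m^2n^2 + n^4$, $D = m^{12} - 26m^{10}n^2 + 79m^8n^4 - 44m^6n^6 + 79m^4n^8 - 26m^2n^{10} + n^{12}$ and $E = m^{12} - 10m^{10}n^2 + 15m^8n^4 - 204m^6n^6 + 15m^4n^8 - 10m^2n^{10} + n^{12}$. For each of the following four triads $(a,b,c)$ of integers, all three of $a, b, c$ are perfect squares and $a+b+c$, $ab+bc+ca$ and $abc$ are all perfect squares: (1) $a = (m^4-n^4)^2R^2$, $b = 4m^2n^2(m^2+n^2)^2R^2$, $c = 64m^4n^4(m^2-n^2)^4$; (2) $a = 64m^4n^4(m^2-n^2)^2$, $b = 16m^2n^2(m^2-n^2)^4$, $c = (m^2+n^2)^2R^2$; (3) $a = 64m^4n^4(m^2-n^2)^2D^2$, $b = (m^2+n^2)^2R^2D^2$, $c = 16m^2n^2(m^2-n^2)^4E^2$; (4) $a = (m^4-n^4)^2R^2E^2$, $b = 64m^4n^4(m^2-n^2)^4E^2$, $c = 4m^2n^2(m^2+n^2)^2R^2D^2$.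
   Context: A perfect square is an integer of the form $k^2$ with $k$ an integer (so $0$ counts as a perfect square). -}

module Defs where

open import Data.Integer using (ℤ; +_; _+_; _-_; _*_; _^_)
open import Data.Product using (_×_; ∃-syntax)
open import Relation.Binary.PropositionalEquality using (_≡_)

PerfectSquare : ℤ → Set
PerfectSquare x = ∃[ k ] x ≡ k ^ 2

SquareTriad : ℤ → ℤ → ℤ → Set
SquareTriad a b c =
  (PerfectSquare a × PerfectSquare b × PerfectSquare c)
  × PerfectSquare (a + b + c)
  × PerfectSquare (a * b + b * c + c * a)
  × PerfectSquare (a * b * c)

R : ℤ → ℤ → ℤ
R m n = m ^ 4 - + 6 * m ^ 2 * n ^ 2 + n ^ 4

D : ℤ → ℤ → ℤ
D m n =
  m ^ 12 - + 26 * m ^ 10 * n ^ 2 + + 79 * m ^ 8 * n ^ 4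
  - + 44 * m ^ 6 * n ^ 6
  + + 79 * m ^ 4 * n ^ 8 - + 26 * m ^ 2 * n ^ 10 + n ^ 12

E : ℤ → ℤ → ℤ
E m n =
  m ^ 12 - + 10 * m ^ 10 * n ^ 2 + + 15 * m ^ 8 * n ^ 4
  - + 204 * m ^ 6 * n ^ 6
  + + 15 * m ^ 4 * n ^ 8 - + 10 * m ^ 2 * n ^ 10 + n ^ 12

{-# OPTIONS --safe #-}

-- Put P = (m² - n²)², Q = 4m²n² and T = (m² + n²)²R².  For arbitrary d, e consider the triads
--   (4PQ²d², Td², 4P²Qe²)   and   (PTe², 4P²Q²e², QTd²).
-- The second elementary symmetric function of each is a square times the sum of the other, so
-- both are square triads as soon as both sums are squares.  Since P + Q = (m² + n²)² and
-- P - Q = R, the sums are binary forms in P and Q.  For d = e = 1 they are (P + Q)³ and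
-- (P² + Q²)², which gives (2) and (1); d = D, e = E, which are also forms in P and Q, give
-- (3) and (4).
module Submission where

open import Defs
open import Data.Integer using (ℤ; +_; _+_; _-_; _*_; _^_; 1ℤ)
open import Data.Integer.Properties using (^-*-assoc; *-assoc; *-identityʳ)
open import Data.Integer.Solver using (module +-*-Solver)
import Data.Nat as ℕ
open import Data.Product using (_×_; _,_; proj₁; proj₂)
open import Relation.Binary.PropositionalEquality
  using (_≡_; refl; sym; trans; cong; cong₂; subst)
open +-*-Solver

square : ∀ k → PerfectSquare (k ^ 2)
square k = k , refl

infixl 7 _*ˢ_

_*ˢ_ : ∀ {x y} → PerfectSquare x → PerfectSquare y → PerfectSquare (x * y)
(i , refl) *ˢ (j , refl) =
  i * j , solve 2 (λ i j → i :^ 2 :* j :^ 2 := (i :* j) :^ 2) refl i j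

4ˢ : PerfectSquare (+ 4)
4ˢ = square (+ 2)

squareTriad : ∀ {a b c} → PerfectSquare a → PerfectSquare b → PerfectSquare c →
  PerfectSquare (a + b + c) → PerfectSquare (a * b + b * c + c * a) → SquareTriad a b c
squareTriad a b c s t = (a , b , c) , s , t , a *ˢ b *ˢ c

SquareTriad-resp : ∀ {a b c a′ b′ c′} → a ≡ a′ → b ≡ b′ → c ≡ c′ →
  SquareTriad a b c → SquareTriad a′ b′ c′
SquareTriad-resp refl refl refl t = t

-- Triads (1) and (2) are the case `d = e = 1` of the dual pair, listed with their last two entries
-- exchanged.
SquareTriad-swap : ∀ {a b c} → SquareTriad a b c → SquareTriad a c b
SquareTriad-swap {a} {b} {c} ((a² , b² , c²) , s , t , _) = squareTriad a² c² b²
  (subst PerfectSquare (solve 3 (λ a b c → a :+ b :+ c := a :+ c :+ b) refl a b c) s)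
  (subst PerfectSquare
    (solve 3 (λ a b c → a :* b :+ b :* c :+ c :* a := a :* c :+ c :* b :+ b :* a) refl a b c) t)

-- At `d = e = 1ℤ` the scaling `1ℤ ^ 2` computes to `1ℤ`, but the trailing product with it does not
-- reduce on open terms.
SquareTriad-cancel-1 : ∀ {a b c} →
  SquareTriad (a * 1ℤ) (b * 1ℤ) (c * 1ℤ) → SquareTriad a b c
SquareTriad-cancel-1 = SquareTriad-resp (*-identityʳ _) (*-identityʳ _) (*-identityʳ _)

sum₁ sum₂ : (P Q T δ ε : ℤ) → ℤ
sum₁ P Q T δ ε = + 4 * P * Q ^ 2 * δ + T * δ + + 4 * P ^ 2 * Q * ε
sum₂ P Q T δ ε = P * T * ε + + 4 * P ^ 2 * Q ^ 2 * ε + Q * T * δ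

-- The pairwise products `bc`, `ca`, `ab` of the first triad are `4PQδ` times the entries of the
-- second, in order; those of the second are `PQTε` times the entries of the first. Both factors are
-- squares.
dualTriads : ∀ {P Q T δ ε} →
  PerfectSquare P → PerfectSquare Q → PerfectSquare T → PerfectSquare δ → PerfectSquare ε →
  PerfectSquare (sum₁ P Q T δ ε) → PerfectSquare (sum₂ P Q T δ ε) →
  SquareTriad (+ 4 * P * Q ^ 2 * δ) (T * δ) (+ 4 * P ^ 2 * Q * ε)
  × SquareTriad (P * T * ε) (+ 4 * P ^ 2 * Q ^ 2 * ε) (Q * T * δ)
dualTriads {P} {Q} {T} {δ} {ε} P² Q² T² δ² ε² s₁ s₂ =
  squareTriad (4ˢ *ˢ P² *ˢ square Q *ˢ δ²) (T² *ˢ δ²) (4ˢ *ˢ square P *ˢ Q² *ˢ ε²) s₁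
    (subst PerfectSquare (pairs₁ P Q T δ ε) (4ˢ *ˢ P² *ˢ Q² *ˢ δ² *ˢ s₂)) ,
  squareTriad (P² *ˢ T² *ˢ ε²) (4ˢ *ˢ square P *ˢ square Q *ˢ ε²) (Q² *ˢ T² *ˢ δ²) s₂
    (subst PerfectSquare (pairs₂ P Q T δ ε) (P² *ˢ Q² *ˢ T² *ˢ ε² *ˢ s₁))
  where
  pairs₁ : ∀ P Q T δ ε →
    let a = + 4 * P * Q ^ 2 * δ; b = T * δ; c = + 4 * P ^ 2 * Q * ε
    in + 4 * P * Q * δ * sum₂ P Q T δ ε ≡ a * b + b * c + c * a
  pairs₁ = solve 5 (λ P Q T δ ε →
    let a = con (+ 4) :* P :* Q :^ 2 :* δ; b = T :* δ; c = con (+ 4) :* P :^ 2 :* Q :* ε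
    in con (+ 4) :* P :* Q :* δ
         :* (P :* T :* ε :+ con (+ 4) :* P :^ 2 :* Q :^ 2 :* ε :+ Q :* T :* δ)
       := a :* b :+ b :* c :+ c :* a) refl

  pairs₂ : ∀ P Q T δ ε →
    let a = P * T * ε; b = + 4 * P ^ 2 * Q ^ 2 * ε; c = Q * T * δ
    in P * Q * T * ε * sum₁ P Q T δ ε ≡ a * b + b * c + c * a
  pairs₂ = solve 5 (λ P Q T δ ε →
    let a = P :* T :* ε; b = con (+ 4) :* P :^ 2 :* Q :^ 2 :* ε; c = Q :* T :* δ
    in P :* Q :* T :* ε
         :* (con (+ 4) :* P :* Q :^ 2 :* δ :+ T :* δ :+ con (+ 4) :* P :^ 2 :* Q :* ε)
       := a :* b :+ b :* c :+ c :* a) refl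

Pₘₙ Qₘₙ Tₘₙ : ℤ → ℤ → ℤ
Pₘₙ m n = (m ^ 2 - n ^ 2) ^ 2
Qₘₙ m n = + 4 * m ^ 2 * n ^ 2
Tₘₙ m n = (m ^ 2 + n ^ 2) ^ 2 * R m n ^ 2

scaledTriads : ∀ m n d e →
  PerfectSquare (sum₁ (Pₘₙ m n) (Qₘₙ m n) (Tₘₙ m n) (d ^ 2) (e ^ 2)) →
  PerfectSquare (sum₂ (Pₘₙ m n) (Qₘₙ m n) (Tₘₙ m n) (d ^ 2) (e ^ 2)) →
  SquareTriad
    (+ 64 * m ^ 4 * n ^ 4 * (m ^ 2 - n ^ 2) ^ 2 * d ^ 2)
    ((m ^ 2 + n ^ 2) ^ 2 * R m n ^ 2 * d ^ 2)
    (+ 16 * m ^ 2 * n ^ 2 * (m ^ 2 - n ^ 2) ^ 4 * e ^ 2)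
  × SquareTriad
    ((m ^ 4 - n ^ 4) ^ 2 * R m n ^ 2 * e ^ 2)
    (+ 64 * m ^ 4 * n ^ 4 * (m ^ 2 - n ^ 2) ^ 4 * e ^ 2)
    (+ 4 * m ^ 2 * n ^ 2 * (m ^ 2 + n ^ 2) ^ 2 * R m n ^ 2 * d ^ 2)
scaledTriads m n d e s₁ s₂ =
  SquareTriad-resp
    (trans (4PQ²δ (m ^ 2) (n ^ 2) (Pₘₙ m n) (d ^ 2))
      (cong₂ (λ u v → + 64 * u * v * Pₘₙ m n * d ^ 2) (quartic m) (quartic n)))
    refl
    (trans (4P²Qε (m ^ 2) (n ^ 2) (Pₘₙ m n ^ 2) (e ^ 2))
      (cong (λ p → + 16 * m ^ 2 * n ^ 2 * p * e ^ 2) (quartic (m ^ 2 - n ^ 2))))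
    (proj₁ triads) ,
  SquareTriad-resp
    (trans (PTε (m ^ 2) (n ^ 2) (R m n ^ 2) (e ^ 2))
      (cong₂ (λ u v → (u - v) ^ 2 * R m n ^ 2 * e ^ 2) (quartic m) (quartic n)))
    -- The entry `4P²Q²ε` is an instance of `4PQ²δ`, with `P²` for `P` and `ε` for `δ`.
    (trans (4PQ²δ (m ^ 2) (n ^ 2) (Pₘₙ m n ^ 2) (e ^ 2))
      (trans (cong₂ (λ u v → + 64 * u * v * Pₘₙ m n ^ 2 * e ^ 2) (quartic m) (quartic n))
        (cong (λ p → + 64 * m ^ 4 * n ^ 4 * p * e ^ 2) (quartic (m ^ 2 - n ^ 2)))))
    (cong (_* d ^ 2) (sym (*-assoc (Qₘₙ m n) ((m ^ 2 + n ^ 2) ^ 2) (R m n ^ 2))))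
    (proj₂ triads)
  where
  triads = dualTriads (square (m ^ 2 - n ^ 2)) (4ˢ *ˢ square m *ˢ square n)
    (square (m ^ 2 + n ^ 2) *ˢ square (R m n)) (square d) (square e) s₁ s₂

  quartic : ∀ i → (i ^ 2) ^ 2 ≡ i ^ 4
  quartic i = ^-*-assoc i 2 2

  4PQ²δ : ∀ x y P δ → + 4 * P * (+ 4 * x * y) ^ 2 * δ ≡ + 64 * x ^ 2 * y ^ 2 * P * δ
  4PQ²δ = solve 4 (λ x y P δ → con (+ 4) :* P :* (con (+ 4) :* x :* y) :^ 2 :* δ
    := con (+ 64) :* x :^ 2 :* y :^ 2 :* P :* δ) refl

  4P²Qε : ∀ x y P² ε → + 4 * P² * (+ 4 * x * y) * ε ≡ + 16 * x * y * P² * ε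
  4P²Qε = solve 4 (λ x y P² ε → con (+ 4) :* P² :* (con (+ 4) :* x :* y) :* ε
    := con (+ 16) :* x :* y :* P² :* ε) refl

  PTε : ∀ x y ρ ε → (x - y) ^ 2 * ((x + y) ^ 2 * ρ) * ε ≡ (x ^ 2 - y ^ 2) ^ 2 * ρ * ε
  PTε = solve 4 (λ x y ρ ε → (x :- y) :^ 2 :* ((x :+ y) :^ 2 :* ρ) :* ε
    := (x :^ 2 :- y :^ 2) :^ 2 :* ρ :* ε) refl

-- A symmetric form of even degree in `x = m²`, `y = n²` involves only even powers of `x + y`, so it
-- is a form in `(x + y)² = P + Q` and `4xy = Q`. Degree 12 in `m`, `n` becomes degree 3 here.
T̂ D̂ Ê : ℤ → ℤ → ℤ
T̂ P Q = (P + Q) * (P - Q) ^ 2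
D̂ P Q = P ^ 3 - + 5 * P ^ 2 * Q - P * Q ^ 2 + Q ^ 3
Ê P Q = P ^ 3 - P ^ 2 * Q - P * Q ^ 2 - + 3 * Q ^ 3

:T̂ :D̂ :Ê : ∀ {k} → Polynomial k → Polynomial k → Polynomial k
:T̂ P Q = (P :+ Q) :* (P :- Q) :^ 2
:D̂ P Q = P :^ 3 :- con (+ 5) :* P :^ 2 :* Q :- P :* Q :^ 2 :+ Q :^ 3
:Ê P Q = P :^ 3 :- P :^ 2 :* Q :- P :* Q :^ 2 :- con (+ 3) :* Q :^ 3

[m²+n²]²≡P+Q : ∀ m n → (m ^ 2 + n ^ 2) ^ 2 ≡ Pₘₙ m n + Qₘₙ m n
[m²+n²]²≡P+Q m n = solve 2 (λ x y → (x :+ y) :^ 2 := (x :- y) :^ 2 :+ con (+ 4) :* x :* y) refl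
  (m ^ 2) (n ^ 2)

R≡P-Q : ∀ m n → R m n ≡ Pₘₙ m n - Qₘₙ m n
R≡P-Q = solve 2 (λ m n → m :^ 4 :- con (+ 6) :* m :^ 2 :* n :^ 2 :+ n :^ 4
  := (m :^ 2 :- n :^ 2) :^ 2 :- con (+ 4) :* m :^ 2 :* n :^ 2) refl

T≡T̂ : ∀ m n → Tₘₙ m n ≡ T̂ (Pₘₙ m n) (Qₘₙ m n)
T≡T̂ m n = cong₂ (λ s r → s * r ^ 2) ([m²+n²]²≡P+Q m n) (R≡P-Q m n)

-- The ring solver's normal forms are dense, so degree 12 in m, n is slow for it; rewriting
-- D and E in terms of m², n² first keeps its input at degree 6.
palindrome-in-squares : ∀ a b c m n → let x = m ^ 2; y = n ^ 2 in
  m ^ 12 - a * m ^ 10 * n ^ 2 + b * m ^ 8 * n ^ 4 - c * m ^ 6 * n ^ 6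
    + b * m ^ 4 * n ^ 8 - a * m ^ 2 * n ^ 10 + n ^ 12
  ≡ x ^ 6 - a * x ^ 5 * y ^ 1 + b * x ^ 4 * y ^ 2 - c * x ^ 3 * y ^ 3
    + b * x ^ 2 * y ^ 4 - a * x ^ 1 * y ^ 5 + y ^ 6
palindrome-in-squares a b c m n =
  cong₂ _+_ (cong₂ _-_ (cong₂ _+_ (cong₂ _-_ (cong₂ _+_ (cong₂ _-_
    (even m 6) (term a 5 1)) (term b 4 2)) (term c 3 3)) (term b 2 4)) (term a 1 5)) (even n 6)
  where
  even : ∀ i k → i ^ (2 ℕ.* k) ≡ (i ^ 2) ^ k
  even i k = sym (^-*-assoc i 2 k)

  term : ∀ c j k → c * m ^ (2 ℕ.* j) * n ^ (2 ℕ.* k) ≡ c * (m ^ 2) ^ j * (n ^ 2) ^ k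
  term c j k = cong₂ (λ u v → c * u * v) (even m j) (even n k)

-- The exponents `1` stay explicit so that the denotation matches the right-hand side of
-- `palindrome-in-squares`.
:palindrome : ∀ {k} (a b c : ℤ) → Polynomial k → Polynomial k → Polynomial k
:palindrome a b c x y =
  x :^ 6 :- con a :* x :^ 5 :* y :^ 1 :+ con b :* x :^ 4 :* y :^ 2
  :- con c :* x :^ 3 :* y :^ 3
  :+ con b :* x :^ 2 :* y :^ 4 :- con a :* x :^ 1 :* y :^ 5 :+ y :^ 6

D≡D̂ : ∀ m n → D m n ≡ D̂ (Pₘₙ m n) (Qₘₙ m n)
D≡D̂ m n = trans (palindrome-in-squares (+ 26) (+ 79) (+ 44) m n)
  (solve 2 (λ x y → :palindrome (+ 26) (+ 79) (+ 44) x y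
    := :D̂ ((x :- y) :^ 2) (con (+ 4) :* x :* y)) refl (m ^ 2) (n ^ 2))

E≡Ê : ∀ m n → E m n ≡ Ê (Pₘₙ m n) (Qₘₙ m n)
E≡Ê m n = trans (palindrome-in-squares (+ 10) (+ 15) (+ 204) m n)
  (solve 2 (λ x y → :palindrome (+ 10) (+ 15) (+ 204) x y
    := :Ê ((x :- y) :^ 2) (con (+ 4) :* x :* y)) refl (m ^ 2) (n ^ 2))

-- At `δ = D̂²`, `ε = Ê²` the sums have degrees 9 and 10: `K₁` is a root of the cofactor of `P + Q`
-- in the first, `K₂` a root of the second.
K₁ K₂ : ℤ → ℤ → ℤ
K₁ P Q = P ^ 4 - + 4 * P ^ 3 * Q + + 10 * P ^ 2 * Q ^ 2 + Q ^ 4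
K₂ P Q = P ^ 5 - P ^ 4 * Q - + 4 * P ^ 3 * Q ^ 2 + + 8 * P ^ 2 * Q ^ 3 + + 3 * P * Q ^ 4 + Q ^ 5

-- The outer terms add to `4PQ(P + Q)`, and `(P - Q)² + 4PQ = (P + Q)²`. The cube is split because
-- `P + Q` is itself a square.
sum₁-1 : ∀ P Q → (P + Q) * (P + Q) ^ 2 ≡ sum₁ P Q (T̂ P Q) 1ℤ 1ℤ
sum₁-1 = solve 2 (λ P Q → let T = :T̂ P Q; 1# = con 1ℤ in
  (P :+ Q) :* (P :+ Q) :^ 2
  := con (+ 4) :* P :* Q :^ 2 :* 1# :+ T :* 1# :+ con (+ 4) :* P :^ 2 :* Q :* 1#) refl

-- The terms in `T` add to `(P + Q)T = (P² - Q²)²`, and `4P²Q²` turns this into `(P² + Q²)²`.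
sum₂-1 : ∀ P Q → (P ^ 2 + Q ^ 2) ^ 2 ≡ sum₂ P Q (T̂ P Q) 1ℤ 1ℤ
sum₂-1 = solve 2 (λ P Q → let T = :T̂ P Q; 1# = con 1ℤ in
  (P :^ 2 :+ Q :^ 2) :^ 2
  := P :* T :* 1# :+ con (+ 4) :* P :^ 2 :* Q :^ 2 :* 1# :+ Q :* T :* 1#) refl

-- The factor `P + Q` is forced: at `Q = -P` the form `T̂` vanishes while `D̂` and `Ê` both equal
-- `4P³`, so the remaining two terms cancel.
sum₁-D̂Ê : ∀ P Q → (P + Q) * K₁ P Q ^ 2 ≡ sum₁ P Q (T̂ P Q) (D̂ P Q ^ 2) (Ê P Q ^ 2)
sum₁-D̂Ê = solve 2 (λ P Q →
  let T = :T̂ P Q; δ = :D̂ P Q :^ 2; ε = :Ê P Q :^ 2 in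
  (P :+ Q)
    :* (P :^ 4 :- con (+ 4) :* P :^ 3 :* Q :+ con (+ 10) :* P :^ 2 :* Q :^ 2 :+ Q :^ 4) :^ 2
  := con (+ 4) :* P :* Q :^ 2 :* δ :+ T :* δ :+ con (+ 4) :* P :^ 2 :* Q :* ε) refl

sum₂-D̂Ê : ∀ P Q → K₂ P Q ^ 2 ≡ sum₂ P Q (T̂ P Q) (D̂ P Q ^ 2) (Ê P Q ^ 2)
sum₂-D̂Ê = solve 2 (λ P Q →
  let T = :T̂ P Q; δ = :D̂ P Q :^ 2; ε = :Ê P Q :^ 2 in
  (P :^ 5 :- P :^ 4 :* Q :- con (+ 4) :* P :^ 3 :* Q :^ 2 :+ con (+ 8) :* P :^ 2 :* Q :^ 3
     :+ con (+ 3) :* P :* Q :^ 4 :+ Q :^ 5) :^ 2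
  := P :* T :* ε :+ con (+ 4) :* P :^ 2 :* Q :^ 2 :* ε :+ Q :* T :* δ) refl

mainTheorem3 : (m n : ℤ) →
  SquareTriad
    ((m ^ 4 - n ^ 4) ^ 2 * R m n ^ 2)
    (+ 4 * m ^ 2 * n ^ 2 * (m ^ 2 + n ^ 2) ^ 2 * R m n ^ 2)
    (+ 64 * m ^ 4 * n ^ 4 * (m ^ 2 - n ^ 2) ^ 4)
  × SquareTriad
    (+ 64 * m ^ 4 * n ^ 4 * (m ^ 2 - n ^ 2) ^ 2)
    (+ 16 * m ^ 2 * n ^ 2 * (m ^ 2 - n ^ 2) ^ 4)
    ((m ^ 2 + n ^ 2) ^ 2 * R m n ^ 2)
  × SquareTriad
    (+ 64 * m ^ 4 * n ^ 4 * (m ^ 2 - n ^ 2) ^ 2 * D m n ^ 2)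
    ((m ^ 2 + n ^ 2) ^ 2 * R m n ^ 2 * D m n ^ 2)
    (+ 16 * m ^ 2 * n ^ 2 * (m ^ 2 - n ^ 2) ^ 4 * E m n ^ 2)
  × SquareTriad
    ((m ^ 4 - n ^ 4) ^ 2 * R m n ^ 2 * E m n ^ 2)
    (+ 64 * m ^ 4 * n ^ 4 * (m ^ 2 - n ^ 2) ^ 4 * E m n ^ 2)
    (+ 4 * m ^ 2 * n ^ 2 * (m ^ 2 + n ^ 2) ^ 2 * R m n ^ 2 * D m n ^ 2)
mainTheorem3 m n =
  SquareTriad-swap (SquareTriad-cancel-1 (proj₂ triads₁)) ,
  SquareTriad-swap (SquareTriad-cancel-1 (proj₁ triads₁)) ,
  scaledTriads m n (D m n) (E m n)
    (subst PerfectSquare (trans (sum₁-D̂Ê P Q) (fromForms sum₁)) (P+Qˢ *ˢ square (K₁ P Q)))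
    (subst PerfectSquare (trans (sum₂-D̂Ê P Q) (fromForms sum₂)) (square (K₂ P Q)))
  where
  P Q : ℤ
  P = Pₘₙ m n
  Q = Qₘₙ m n

  P+Qˢ : PerfectSquare (P + Q)
  P+Qˢ = subst PerfectSquare ([m²+n²]²≡P+Q m n) (square (m ^ 2 + n ^ 2))

  T̂≡T : T̂ P Q ≡ Tₘₙ m n
  T̂≡T = sym (T≡T̂ m n)

  triads₁ = scaledTriads m n 1ℤ 1ℤ
    (subst PerfectSquare (trans (sum₁-1 P Q) (cong (λ T → sum₁ P Q T 1ℤ 1ℤ) T̂≡T))
      (P+Qˢ *ˢ square (P + Q)))
    (subst PerfectSquare (trans (sum₂-1 P Q) (cong (λ T → sum₂ P Q T 1ℤ 1ℤ) T̂≡T))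
      (square (P ^ 2 + Q ^ 2)))

  -- Abstracting over `f` lets one transport serve both `sum₁` and `sum₂`.
  fromForms : (f : ℤ → ℤ → ℤ → ℤ → ℤ → ℤ) →
    f P Q (T̂ P Q) (D̂ P Q ^ 2) (Ê P Q ^ 2) ≡ f P Q (Tₘₙ m n) (D m n ^ 2) (E m n ^ 2)
  fromForms f = trans (cong (λ T → f P Q T (D̂ P Q ^ 2) (Ê P Q ^ 2)) T̂≡T)
    (cong₂ (λ d e → f P Q (Tₘₙ m n) (d ^ 2) (e ^ 2)) (sym (D≡D̂ m n)) (sym (E≡Ê m n)))
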